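{- Let $\mathcal{A}=\{A_1,\dots,A_m\}$ be a bimodal collection of pairwise disjoint nonempty subsets of a finite abelian group $G$, with internal difference groups $H_1,\dots,H_m$, such that $|A_1|<|H_1|$ and $|A_i|=|H_i|$ for all $2\le i\le m$. Let $D=H_2+H_3+\dots+H_m$, and suppose $\mathcal{A}$ is in canonical position, i.e. $A_1\subseteq H_1$ and $D\subseteq H_1\setminus A_1$. Then: (1) $A_1\subseteq H_1\setminus D$ and $A_1$ is a union of cosets of $D$; (2) each $A_i$ with $2\le i\le m$ is a coset of $H_i$, and $A_2,\dots,A_m$ arise from a subdivision of cosets of $H_1$, i.e. $A_2\cup\dots\cup A_m$ is a union of cosets of $H_1$ and each $A_i$ ($i\ge2$) is contained in a single coset of $H_1$.
   Context: $G$ is written additively. The internal difference group $H_i$ of $A_i$ is the subgroup generated by all $x-y$ with $x,y\in A_i$; $A_i$ lies in a single coset of $H_i$ and $|A_i|\le|H_i|$. A collection $\{A_1,\dots,A_m\}$ of pairwise disjoint subsets of $G$ is bimodal if for every $i$ and every $\delta\in G\setminus\{0\}$, the number $N_i(\delta)$ of pairs $(a,b)$ with $a\in A_i$, $b\in A_j$ for some $j\neq i$, and $a-b=\delta$, satisfies $N_i(\delta)\in\{0,|A_i|\}$. An empty sum of subgroups is $\{0\}$. -}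

module Defs where

open import Level using (Level; _⊔_)
open import Algebra.Bundles using (AbelianGroup)
open import Data.Fin.Base using (Fin)
open import Data.Nat.Base using (ℕ; _<_)
open import Data.Product.Base using (∃; ∃₂; _×_; _,_; proj₁)
open import Data.Product.Relation.Binary.Pointwise.NonDependent using (_×ₛ_)
open import Data.Sum.Base using (_⊎_)
open import Function.Bundles using (Inverse)
open import Relation.Binary.Bundles using (Setoid)
import Relation.Binary.Construct.On as On
open import Relation.Binary.PropositionalEquality using (_≡_; _≢_; setoid)
open import Relation.Unary using (Pred; _∈_; _⊆_; _≐_)

private
  variable
    a b e p q : Level

Finite : Setoid a e → Set (a ⊔ e)
Finite S = ∃ λ n → Inverse (setoid (Fin n)) S

-- ∣ P ∣ = k, counting elements up to the equality of S: proofs of membership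
-- are ignored, so an element with several such proofs is counted once.
HasCard : (S : Setoid a e) → Pred (Setoid.Carrier S) p → ℕ → Set (a ⊔ e ⊔ p)
HasCard S P k = Inverse (setoid (Fin k)) (On.setoid S (proj₁ {B = P}))

SameCard : (S : Setoid a e) → Pred (Setoid.Carrier S) p →
           Pred (Setoid.Carrier S) q → Set (a ⊔ e ⊔ p ⊔ q)
SameCard S P Q = ∃ λ k → HasCard S P k × HasCard S Q k

SmallerCard : (S : Setoid a e) → Pred (Setoid.Carrier S) p →
              Pred (Setoid.Carrier S) q → Set (a ⊔ e ⊔ p ⊔ q)
SmallerCard S P Q = ∃₂ λ k l → HasCard S P k × HasCard S Q l × k < l

module InAbelianGroup {c ℓ} (G : AbelianGroup c ℓ) where

  open AbelianGroup G using (Carrier; _≈_; _≉_; _-_; commutativeMonoid)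
    renaming (_∙_ to infixl 6 _+_; ε to 0#; _⁻¹ to infix 8 -_; setoid to ≈-setoid)
  open import Algebra.Properties.CommutativeMonoid.Sum commutativeMonoid using (sum)

  data ⟨_⟩ (S : Pred Carrier p) : Pred Carrier (c ⊔ ℓ ⊔ p) where
    generator  : ∀ {x}   → x ∈ S → x ∈ ⟨ S ⟩
    0#-closed  : 0# ∈ ⟨ S ⟩
    +-closed   : ∀ {x y} → x ∈ ⟨ S ⟩ → y ∈ ⟨ S ⟩ → x + y ∈ ⟨ S ⟩
    neg-closed : ∀ {x}   → x ∈ ⟨ S ⟩ → - x ∈ ⟨ S ⟩
    ≈-closed   : ∀ {x y} → x ≈ y → x ∈ ⟨ S ⟩ → y ∈ ⟨ S ⟩

  Differences : Pred Carrier p → Pred Carrier (c ⊔ ℓ ⊔ p)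
  Differences A z = ∃₂ λ x y → x ∈ A × y ∈ A × z ≈ x - y

  InternalDifferenceGroup : Pred Carrier p → Pred Carrier (c ⊔ ℓ ⊔ p)
  InternalDifferenceGroup A = ⟨ Differences A ⟩

  SumOfSubgroups : ∀ {k} → (Fin k → Pred Carrier p) → Pred Carrier (c ⊔ ℓ ⊔ p)
  SumOfSubgroups {k = k} K x =
    ∃ λ (h : Fin k → Carrier) → (∀ i → h i ∈ K i) × x ≈ sum h

  Coset : Carrier → Pred Carrier p → Pred Carrier (c ⊔ ℓ ⊔ p)
  Coset g K x = ∃ λ h → h ∈ K × x ≈ g + h

  IsCosetOf : Pred Carrier p → Pred Carrier q → Set (c ⊔ ℓ ⊔ p ⊔ q)
  IsCosetOf A K = ∃ λ g → A ≐ Coset g K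

  InSingleCosetOf : Pred Carrier p → Pred Carrier q → Set (c ⊔ ℓ ⊔ p ⊔ q)
  InSingleCosetOf A K = ∃ λ g → A ⊆ Coset g K

  -- R is the set of g for which the coset g + K takes part in the union; it may
  -- be empty, so the empty set counts as a union of cosets.
  IsUnionOfCosetsOf : Pred Carrier p → Pred Carrier q → Set _
  IsUnionOfCosetsOf {p = p} A K =
    ∃ λ (R : Pred Carrier p) → A ≐ λ x → ∃ λ g → g ∈ R × x ∈ Coset g K

  module _ {m} (A : Fin m → Pred Carrier p) where

    -- The pairs counted by Nᵢ(δ).
    ExternalPairs : Fin m → Carrier → Pred (Carrier × Carrier) (ℓ ⊔ p)
    ExternalPairs i δ (x , y) =
      x ∈ A i × (∃ λ j → j ≢ i × y ∈ A j) × x - y ≈ δ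

    Bimodal : Set (c ⊔ ℓ ⊔ p)
    Bimodal = ∀ i δ → δ ≉ 0# → ∃₂ λ N k →
      HasCard (≈-setoid ×ₛ ≈-setoid) (ExternalPairs i δ) N ×
      HasCard ≈-setoid (A i) k ×
      (N ≡ 0 ⊎ N ≡ k)

{-# OPTIONS --safe #-}
-- Bimodality says that whenever a ∈ Aᵢ and b lies in another block, the whole
-- translate Aᵢ + (b - a) lies in the union of the other blocks. For i = 1 this
-- makes B = A₂ ∪ … ∪ Aₘ invariant under H₁. For i ≥ 2 it moves a point of A₁ by
-- an element of Hᵢ ⊆ D ⊆ H₁ to a point of A₁ or of B; the latter is impossible
-- because the H₁-invariance of B would bring the original point into B. Hence
-- A₁ is invariant under every Hᵢ with i ≥ 2, and so under D.
module Submission where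

open import Level using (Level; _⊔_)
open import Algebra.Bundles using (AbelianGroup)
open import Data.Empty using (⊥-elim)
open import Data.Fin.Base using (Fin; zero; suc; punchOut)
open import Data.Fin.Properties using (any?; injective⇒≤; punchOut-injective; _≟_)
open import Data.Nat.Base using (ℕ)
open import Data.Nat.Properties using (1+n≰n)
open import Data.Product.Base using (∃; _×_; _,_; proj₁; proj₂)
open import Data.Sum.Base using (inj₁; inj₂)
open import Data.Vec.Functional using (replicate; updateAt)
open import Function.Base using (_∘_; const)
open import Function.Bundles using (Inverse)
open import Function.Definitions using (Injective)
open import Relation.Binary.Bundles using (Setoid)
open import Relation.Binary.Definitions using (_Respects_)
open import Relation.Binary.PropositionalEquality as ≡ using (_≡_; _≢_)
open import Relation.Nullary.Decidable using (yes; no)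
open import Relation.Unary using (Pred; Decidable; Satisfiable; _∈_; _⊆_; _∖_; _⊥_; ⋃)
open import Defs

private
  variable
    a b e f p q : Level

-- Pigeonhole: if a value `y` were missed, deleting it from the codomain with `punchOut` would leave
-- an injection into a set with one element fewer.
injective⇒surjective : ∀ {n} {g : Fin n → Fin n} → Injective _≡_ _≡_ g →
                       ∀ y → ∃ λ x → g x ≡ y
injective⇒surjective {ℕ.suc n} {g} inj y with any? (λ x → g x ≟ y)
... | yes hit = hit
... | no miss = ⊥-elim (1+n≰n (injective⇒≤ {f = λ x → punchOut (y≢g x)}
                  (inj ∘ punchOut-injective (y≢g _) (y≢g _))))
  where
  y≢g : ∀ x → y ≢ g x
  y≢g x y≡gx = miss (x , ≡.sym y≡gx)

module _ {S : Setoid a e} {T : Setoid b f}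
         {P : Pred (Setoid.Carrier S) p} {Q : Pred (Setoid.Carrier T) q} where

  private
    module S = Setoid S
    module T = Setoid T

  -- Conjugating `g` by the two enumerations gives an injective self-map of `Fin k`. The setoids may
  -- differ because the map needed later goes from pairs of group elements to single elements.
  injective⇒surjective-card :
    ∀ {k} → HasCard S P k → HasCard T Q k →
    (g : S.Carrier → T.Carrier) → (∀ {x} → x ∈ P → g x ∈ Q) →
    (∀ {x y} → x ∈ P → y ∈ P → g x T.≈ g y → x S.≈ y) →
    ∀ {z} → z ∈ Q → ∃ λ x → x ∈ P × g x T.≈ z
  injective⇒surjective-card {k} #P #Q g g∈Q g-inj {z} z∈Q =
    let i , φi≡z = injective⇒surjective φ-inj (Q.from (z , z∈Q))
        x , x∈P  = P.to i
    in x , x∈P , Q-from-inj {g x , g∈Q x∈P} {z , z∈Q} φi≡z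
    where
    module P = Inverse #P
    module Q = Inverse #Q

    Q-from-inj : ∀ {u v} → Q.from u ≡ Q.from v → proj₁ u T.≈ proj₁ v
    Q-from-inj {u} {v} eq = T.trans (T.sym (Q.strictlyInverseˡ u))
      (T.trans (Q.to-cong eq) (Q.strictlyInverseˡ v))

    φ : Fin k → Fin k
    φ i = let x , x∈P = P.to i in Q.from (g x , g∈Q x∈P)

    φ-inj : Injective _≡_ _≡_ φ
    φ-inj {i} {j} eq = ≡.trans (≡.sym (P.strictlyInverseʳ i))
      (≡.trans (P.from-cong (g-inj (proj₂ (P.to i)) (proj₂ (P.to j)) (Q-from-inj eq)))
        (P.strictlyInverseʳ j))

module _ {c ℓ} (G : AbelianGroup c ℓ) where

  open AbelianGroup G
    renaming (_∙_ to infixl 6 _+_; ε to 0#; _⁻¹ to infix 8 -_)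
  open InAbelianGroup G
  open import Algebra.Properties.AbelianGroup G
  open import Algebra.Properties.CommutativeMonoid.Sum commutativeMonoid
    using (sum; sum-replicate-zero)
  open import Relation.Binary.Reasoning.Setoid setoid

  x+[y-x]≈y : ∀ x y → x + (y - x) ≈ y
  x+[y-x]≈y x y = trans (comm x (y - x)) (//-rightDividesˡ x y)

  -- Once the difference is fixed, the first component of a pair determines the second. This both
  -- makes the first projection of the external pairs injective and locates the partner of a given
  -- `x`.
  x-y≈a-b⇒b+[x-a]≈y : ∀ {x y a b} → x - y ≈ a - b → b + (x - a) ≈ y
  x-y≈a-b⇒b+[x-a]≈y {x} {y} {a} {b} eq = begin
    b + (x - a)  ≈⟨ assoc b x (- a) ⟨
    b + x - a    ≈⟨ ∙-congʳ (comm b x) ⟩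
    x + b - a    ≈⟨ assoc x b (- a) ⟩
    x + (b - a)  ≈⟨ ∙-congˡ (⁻¹-anti-homo‿- a b) ⟨
    x - (a - b)  ≈⟨ ∙-congˡ (⁻¹-cong eq) ⟨
    x - (x - y)  ≈⟨ ∙-congˡ (⁻¹-anti-homo‿- x y) ⟩
    x + (y - x)  ≈⟨ x+[y-x]≈y x y ⟩
    y            ∎

  -- The two conditions together say that `P` equals its translate by `d`. Requiring both makes
  -- closure under negation immediate, without an appeal to finiteness.
  Stabiliser : Pred Carrier p → Pred Carrier (c ⊔ p)
  Stabiliser P d = (∀ {x} → x ∈ P → x + d ∈ P) × (∀ {x} → x ∈ P → x - d ∈ P)

  module _ {P : Pred Carrier p} (resp : P Respects _≈_) where

    stabiliser-≈ : Stabiliser P Respects _≈_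
    stabiliser-≈ d≈e (+d , -d) =
      (λ x∈P → resp (∙-congˡ d≈e) (+d x∈P)) ,
      (λ x∈P → resp (∙-congˡ (⁻¹-cong d≈e)) (-d x∈P))

    stabiliser-0# : 0# ∈ Stabiliser P
    stabiliser-0# =
      resp (sym (identityʳ _)) ,
      resp (sym (trans (∙-congˡ ε⁻¹≈ε) (identityʳ _)))

    stabiliser-+ : ∀ {d e} → d ∈ Stabiliser P → e ∈ Stabiliser P → d + e ∈ Stabiliser P
    stabiliser-+ {d} {e} (+d , -d) (+e , -e) =
      (λ x∈P → resp (assoc _ d e) (+e (+d x∈P))) ,
      (λ x∈P → resp (trans (assoc _ (- d) (- e)) (∙-congˡ (⁻¹-∙-comm d e))) (-e (-d x∈P)))

    stabiliser-neg : ∀ {d} → d ∈ Stabiliser P → - d ∈ Stabiliser P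
    stabiliser-neg (+d , -d) =
      -d , (λ x∈P → resp (∙-congˡ (sym (⁻¹-involutive _))) (+d x∈P))

    ⟨⟩⊆stabiliser : {S : Pred Carrier q} → S ⊆ Stabiliser P → ⟨ S ⟩ ⊆ Stabiliser P
    ⟨⟩⊆stabiliser S⊆ (generator s)    = S⊆ s
    ⟨⟩⊆stabiliser S⊆ 0#-closed        = stabiliser-0#
    ⟨⟩⊆stabiliser S⊆ (+-closed s t)   = stabiliser-+ (⟨⟩⊆stabiliser S⊆ s) (⟨⟩⊆stabiliser S⊆ t)
    ⟨⟩⊆stabiliser S⊆ (neg-closed s)   = stabiliser-neg (⟨⟩⊆stabiliser S⊆ s)
    ⟨⟩⊆stabiliser S⊆ (≈-closed x≈y s) = stabiliser-≈ x≈y (⟨⟩⊆stabiliser S⊆ s)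

    -- It suffices to treat the generators `y - z`. Since `shift` holds for all ordered pairs,
    -- exchanging `y` and `z` supplies the translation by the negative.
    internalDifferenceGroup⊆stabiliser : {A : Pred Carrier q} →
      (∀ {x y z} → x ∈ P → y ∈ A → z ∈ A → x + (y - z) ∈ P) →
      InternalDifferenceGroup A ⊆ Stabiliser P
    internalDifferenceGroup⊆stabiliser shift = ⟨⟩⊆stabiliser λ (y , z , y∈A , z∈A , d≈) →
      stabiliser-≈ (sym d≈)
        ( (λ x∈P → shift x∈P y∈A z∈A)
        , (λ x∈P → resp (∙-congˡ (sym (⁻¹-anti-homo‿- y z))) (shift x∈P z∈A y∈A)))

    sum∈stabiliser : ∀ {k} (h : Fin k → Carrier) → (∀ i → h i ∈ Stabiliser P) →
                     sum h ∈ Stabiliser P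
    sum∈stabiliser {ℕ.zero}  h h∈ = stabiliser-0#
    sum∈stabiliser {ℕ.suc k} h h∈ =
      stabiliser-+ (h∈ zero) (sum∈stabiliser (h ∘ suc) (h∈ ∘ suc))

    sumOfSubgroups⊆stabiliser : ∀ {k} {K : Fin k → Pred Carrier q} →
      (∀ i → K i ⊆ Stabiliser P) → SumOfSubgroups K ⊆ Stabiliser P
    sumOfSubgroups⊆stabiliser K⊆ (h , h∈K , x≈) =
      stabiliser-≈ (sym x≈) (sum∈stabiliser h (λ i → K⊆ i (h∈K i)))

    -- Every point of `P` serves as a representative of its own coset, so `P` itself is the set of
    -- representatives.
    ⊆stabiliser⇒unionOfCosets : {K : Pred Carrier q} → 0# ∈ K → K ⊆ Stabiliser P →
                                IsUnionOfCosetsOf P K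
    ⊆stabiliser⇒unionOfCosets 0∈K K⊆ = P ,
      (λ {x} x∈P → x , x∈P , 0# , 0∈K , sym (identityʳ x)) ,
      (λ (g , g∈P , h , h∈K , x≈g+h) → resp (sym x≈g+h) (proj₁ (K⊆ h∈K) g∈P))

  single : ∀ {k} → Fin k → Carrier → Fin k → Carrier
  single {k} i x = updateAt (replicate k 0#) i (const x)

  sum-single : ∀ {k} (i : Fin k) x → sum (single i x) ≈ x
  sum-single {ℕ.suc k} zero    x = trans (∙-congˡ (sum-replicate-zero k)) (identityʳ x)
  sum-single {ℕ.suc k} (suc i) x = trans (identityˡ _) (sum-single i x)

  single-∈ : ∀ {k} {K : Fin k → Pred Carrier p} → (∀ j → 0# ∈ K j) →
             ∀ i {x} → x ∈ K i → ∀ j → single i x j ∈ K j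
  single-∈ 0∈K zero    x∈K zero    = x∈K
  single-∈ 0∈K zero    x∈K (suc j) = 0∈K (suc j)
  single-∈ 0∈K (suc i) x∈K zero    = 0∈K zero
  single-∈ {K = K} 0∈K (suc i) x∈K (suc j) = single-∈ {K = K ∘ suc} (0∈K ∘ suc) i x∈K j

  0#∈sumOfSubgroups : ∀ {k} {K : Fin k → Pred Carrier p} → (∀ j → 0# ∈ K j) →
                      0# ∈ SumOfSubgroups K
  0#∈sumOfSubgroups {k = k} 0∈K = replicate k 0# , 0∈K , sym (sum-replicate-zero k)

  summand⊆sumOfSubgroups : ∀ {k} {K : Fin k → Pred Carrier p} → (∀ j → 0# ∈ K j) →
                           ∀ i → K i ⊆ SumOfSubgroups K
  summand⊆sumOfSubgroups {K = K} 0∈K i {x} x∈K =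
    single i x , single-∈ {K = K} 0∈K i x∈K , sym (sum-single i x)

  -- x ↦ x - g injects A into its internal difference group; equal cardinalities
  -- make it onto.
  sameCard⇒coset : {A : Pred Carrier p} → A Respects _≈_ → Satisfiable A →
                   SameCard setoid A (InternalDifferenceGroup A) →
                   IsCosetOf A (InternalDifferenceGroup A)
  sameCard⇒coset {A = A} resp (g , g∈A) (k , #A , #H) = g ,
    (λ {x} x∈A → x - g , x-g∈H x∈A , sym (x+[y-x]≈y g x)) ,
    (λ {y} (h , h∈H , y≈g+h) →
      let x , x∈A , x-g≈h = injective⇒surjective-card #A #H (_- g) x-g∈H
            (λ {x} {y} _ _ → ∙-cancelʳ (- g) x y) h∈H
      in resp (begin
           x            ≈⟨ x+[y-x]≈y g x ⟨
           g + (x - g)  ≈⟨ ∙-congˡ x-g≈h ⟩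
           g + h        ≈⟨ y≈g+h ⟨
           y            ∎) x∈A)
    where
    x-g∈H : ∀ {x} → x ∈ A → x - g ∈ InternalDifferenceGroup A
    x-g∈H {x} x∈A = generator (x , g , x∈A , g∈A , refl)

  module _ {m} {A : Fin m → Pred Carrier p}
           (resp : ∀ i → A i Respects _≈_)
           (disjoint : ∀ i j → i ≢ j → A i ⊥ A j)
           (bimodal : Bimodal A) where

    -- The hypotheses exhibit a pair with difference a - b, so Nᵢ(a - b) = ∣ Aᵢ ∣:
    -- every x ∈ Aᵢ is the first component of such a pair.
    bimodal-translate : ∀ {i j a b x} → j ≢ i → a ∈ A i → b ∈ A j → x ∈ A i →
                        ∃ λ l → l ≢ i × b + (x - a) ∈ A l
    bimodal-translate {i} {j} {a} {b} {x} j≢i a∈ b∈ x∈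
      -- The difference is nonzero: otherwise `a` and `b` would be equal, and `b` would lie in two
      -- disjoint blocks.
      with bimodal i (a - b) (λ a-b≈0 →
             disjoint j i j≢i (b∈ , resp i (x∙y⁻¹≈ε⇒x≈y a b a-b≈0) a∈))
    ... | _ , k , #pairs , #A , inj₁ ≡.refl
          with () ← Inverse.from #pairs ((a , b) , a∈ , (j , j≢i , b∈) , refl)
    ... | _ , k , #pairs , #A , inj₂ ≡.refl =
      let (x′ , y) , (_ , (l , l≢i , y∈) , x′-y≈a-b) , x′≈x =
            injective⇒surjective-card #pairs #A proj₁ proj₁
              -- Injectivity of the first projection: both second components equal `b` plus the
              -- first component minus `a`.
              (λ (_ , _ , p) (_ , _ , q) x≈ → x≈ , trans (sym (x-y≈a-b⇒b+[x-a]≈y p))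
                (trans (∙-congˡ (∙-congʳ x≈)) (x-y≈a-b⇒b+[x-a]≈y q)))
              x∈
      in l , l≢i , resp l (trans (sym (x-y≈a-b⇒b+[x-a]≈y x′-y≈a-b))
           (∙-congˡ (∙-congʳ x′≈x))) y∈

theorem3p15 :
  ∀ {c ℓ p : Level} (G : AbelianGroup c ℓ) →
  let open AbelianGroup G
      open InAbelianGroup G
  in
  Finite setoid →
  (n : ℕ) (A : Fin (ℕ.suc n) → Pred Carrier p) →
  (∀ i → A i Respects _≈_) →
  (∀ i → Decidable (A i)) →
  (∀ i → Satisfiable (A i)) →
  (∀ i j → i ≢ j → A i ⊥ A j) →
  Bimodal A →
  let H = λ i → InternalDifferenceGroup (A i)
      D = SumOfSubgroups (λ i → H (suc i))
  in
  SmallerCard setoid (A zero) (H zero) →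
  (∀ i → SameCard setoid (A (suc i)) (H (suc i))) →
  A zero ⊆ H zero →
  D ⊆ H zero ∖ A zero →
  (A zero ⊆ H zero ∖ D × IsUnionOfCosetsOf (A zero) D) ×
  ((∀ i → IsCosetOf (A (suc i)) (H (suc i))) ×
   IsUnionOfCosetsOf (⋃ (Fin n) (λ i → A (suc i))) (H zero) ×
   (∀ i → InSingleCosetOf (A (suc i)) (H zero)))
theorem3p15 G _ n A resp _ nonempty disjoint bimodal _ sameCard A₀⊆H₀ D⊆H₀∖A₀ =
  ( (λ x∈A₀ → A₀⊆H₀ x∈A₀ , λ x∈D → proj₂ (D⊆H₀∖A₀ x∈D) x∈A₀)
  , ⊆stabiliser⇒unionOfCosets G (resp zero) (0#∈sumOfSubgroups G {K = H′} 0∈H′)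
      (sumOfSubgroups⊆stabiliser G (resp zero) H′⊆stabA₀)) ,
  (isCoset
  , ⊆stabiliser⇒unionOfCosets G B-resp 0#-closed H₀⊆stabB
  -- The representative for `H′ i` also works for the larger group `H₀`.
  , λ i → let g , A⊆g+H , _ = isCoset i in
      g , λ x∈A → let h , h∈H , x≈g+h = A⊆g+H x∈A in h , H′⊆H₀ i h∈H , x≈g+h)
  where
  open AbelianGroup G
  open InAbelianGroup G
  open import Algebra.Properties.AbelianGroup G using (//-rightDividesʳ)

  H₀ = InternalDifferenceGroup (A zero)
  H′ = λ i → InternalDifferenceGroup (A (suc i))
  B  = ⋃ (Fin n) (λ i → A (suc i))

  0∈H′ : ∀ i → ε ∈ H′ i
  0∈H′ i = 0#-closed

  isCoset : ∀ i → IsCosetOf (A (suc i)) (H′ i)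
  isCoset i = sameCard⇒coset G (resp (suc i)) (nonempty (suc i)) (sameCard i)

  H′⊆H₀ : ∀ i → H′ i ⊆ H₀
  H′⊆H₀ i x∈H = proj₁ (D⊆H₀∖A₀ (summand⊆sumOfSubgroups G {K = H′} 0∈H′ i x∈H))

  B-resp : B Respects _≈_
  B-resp x≈y (i , x∈A) = i , resp (suc i) x≈y x∈A

  H₀⊆stabB : H₀ ⊆ Stabiliser G B
  H₀⊆stabB = internalDifferenceGroup⊆stabiliser G B-resp shift
    where
    shift : ∀ {x y z} → x ∈ B → y ∈ A zero → z ∈ A zero → x ∙ (y - z) ∈ B
    -- The pair `(z , x)` moves block `zero` by `x - z`, sending `y` to `x ∙ (y - z)`. The target
    -- block is not `zero`, so the image lies in `B`.
    shift (i , x∈) y∈ z∈ with bimodal-translate G resp disjoint bimodal (λ ()) z∈ x∈ y∈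
    ... | zero  , 0≢0 , _ = ⊥-elim (0≢0 ≡.refl)
    ... | suc j , _   , ∈A = j , ∈A

  H′⊆stabA₀ : ∀ i → H′ i ⊆ Stabiliser G (A zero)
  H′⊆stabA₀ i = internalDifferenceGroup⊆stabiliser G (resp zero) shift
    where
    shift : ∀ {x y z} → x ∈ A zero → y ∈ A (suc i) → z ∈ A (suc i) → x ∙ (y - z) ∈ A zero
    shift {x} {y} {z} x∈ y∈ z∈ with bimodal-translate G resp disjoint bimodal (λ ()) z∈ x∈ y∈
    ... | zero  , _ , ∈A = ∈A
    -- Here the translate of `x` lies in `B`. Subtracting `y - z`, an element of `H₀` and hence of
    -- the stabiliser of `B`, would put `x` itself in `B`, against disjointness.
    ... | suc j , _ , ∈A =
      let y-z∈H₀  = H′⊆H₀ i (generator (y , z , y∈ , z∈ , refl))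
          l , x∈B = B-resp (//-rightDividesʳ (y - z) x) (proj₂ (H₀⊆stabB y-z∈H₀) (j , ∈A))
      in ⊥-elim (disjoint zero (suc l) (λ ()) (x∈ , x∈B))
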